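{- Let $p\ge3$ be a prime and let $G$ be a graph. Let $G^{(p-2)}$ be the multigraph obtained from $G$ by replacing each edge with $p-2$ parallel edges, and let $H$ be a spanning subgraph of $G^{(p-2)}$ with exactly $(p-1)(|V(G)|-1)$ edges. If, for some $u\in V(H)$, $H$ has an orientation $D$ in which $\deg^+_D(v)=p-1$ for each $v\in V(G)\setminus\{u\}$ and such that $EE(D)-EO(D)\not\equiv 0\pmod p$, then $G$ is $\mathbb Z_p$-connected.
   Context: For an orientation $D$ of a (multi)graph $H$, a spanning subgraph of $H$ (a subset of its edges) is Eulerian with respect to $D$ if every vertex has equal in-degree and out-degree in the restriction of $D$ to that subgraph; it is even or odd according to the parity of its number of edges. $EE(D)$ and $EO(D)$ denote the numbers of even and odd Eulerian subgraphs with respect to $D$. A graph $G$ (with an arbitrary fixed orientation, giving out-arcs $E^+(v)$ and in-arcs $E^-(v)$ at each vertex) is $\mathbb Z_p$-connected if for every $b:V(G)\to\mathbb Z_p$ with $\sum_{v}b(v)=0$ there exists $\phi:E(G)\to\mathbb Z_p\setminus\{0\}$ with $\sum_{e\in E^+(v)}\phi(e)-\sum_{e\in E^-(v)}\phi(e)=b(v)$ for all $v\in V(G)$. -}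

module Defs where

open import Data.Nat using (ℕ; zero; suc; _+_; _*_; _∸_; _≤_)
open import Data.Integer as ℤ using (ℤ; +_)
open import Data.Integer.Divisibility using () renaming (_∣_ to _∣ℤ_)
open import Data.Fin using (Fin; zero; suc)
open import Data.Fin.Properties using (_≟_)
open import Data.Bool using (Bool; true; false; if_then_else_)
open import Data.Vec using (Vec; []; _∷_; lookup)
open import Data.List using (List; []; _∷_; map; _++_)
open import Data.Product using (Σ; _×_; _,_; proj₁; proj₂)
open import Relation.Nullary using (¬_; Dec; yes; no; does)
open import Relation.Binary.PropositionalEquality using (_≡_; _≢_)

Σℕ : (k : ℕ) → (Fin k → ℕ) → ℕ
Σℕ zero    f = 0
Σℕ (suc k) f = f zero + Σℕ k (λ i → f (suc i))

Σℤ : (k : ℕ) → (Fin k → ℤ) → ℤ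
Σℤ zero    f = + 0
Σℤ (suc k) f = f zero ℤ.+ Σℤ k (λ i → f (suc i))

[_] : Bool → ℕ
[ true ]  = 1
[ false ] = 0

-- A loopless multigraph with vertex set Fin n and edge set Fin m.
-- Edge e has ends (tail e , head e); this also fixes the arbitrary
-- reference orientation used in the definition of Z_p-connectivity.
record Graph : Set where
  field
    n     : ℕ
    m     : ℕ
    tail  : Fin m → Fin n
    head  : Fin m → Fin n
    loopless : (e : Fin m) → tail e ≢ head e
open Graph public

netflow : (G : Graph) → (Fin (m G) → ℤ) → Fin (n G) → ℤ
netflow G φ v = Σℤ (m G) (λ e →
  (if does (tail G e ≟ v) then φ e else + 0) ℤ.-
  (if does (head G e ≟ v) then φ e else + 0))

-- Z_p-connectivity, with Z_p represented by ℤ modulo p: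
-- every b : V → Z_p with Σ b = 0 has a nowhere-zero φ : E → Z_p with
-- ∂φ = b.
ZpConnected : (p : ℕ) → Graph → Set
ZpConnected p G =
  (b : Fin (n G) → ℤ) → (+ p) ∣ℤ Σℤ (n G) b →
  Σ (Fin (m G) → ℤ) λ φ →
    ((e : Fin (m G)) → ¬ ((+ p) ∣ℤ φ e)) ×
    ((v : Fin (n G)) → (+ p) ∣ℤ (netflow G φ v ℤ.- b v))

-- A spanning subgraph H of G^(k) (each edge replaced by k parallel
-- copies) with h edges: edge j of H is the copy (orig j , copy j) of
-- the G-edge orig j, and distinct H-edges are distinct copies.
record SubMulti (G : Graph) (k : ℕ) (h : ℕ) : Set where
  field
    orig : Fin h → Fin (m G)
    copy : Fin h → Fin k
    injective : (i j : Fin h) → orig i ≡ orig j → copy i ≡ copy j → i ≡ j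
open SubMulti public

-- An orientation of H: dir j = true means edge j is oriented
-- tail G (orig j) → head G (orig j), false means the reverse.
Orientation : (h : ℕ) → Set
Orientation h = Fin h → Bool

module _ {G : Graph} {k h : ℕ} (H : SubMulti G k h) (D : Orientation h) where

  dtail : Fin h → Fin (n G)
  dtail j = if D j then tail G (orig H j) else head G (orig H j)

  dhead : Fin h → Fin (n G)
  dhead j = if D j then head G (orig H j) else tail G (orig H j)

  outdegIn : Vec Bool h → Fin (n G) → ℕ
  outdegIn T v = Σℕ h (λ j → [ lookup T j ] * [ does (dtail j ≟ v) ])

  indegIn : Vec Bool h → Fin (n G) → ℕ
  indegIn T v = Σℕ h (λ j → [ lookup T j ] * [ does (dhead j ≟ v) ])

  outdeg : Fin (n G) → ℕ
  outdeg v = Σℕ h (λ j → [ does (dtail j ≟ v) ])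

  eulerian? : Vec Bool h → Bool
  eulerian? T = allV (n G) (λ v → does (outdegIn T v Data.Nat.≟ indegIn T v))
    where
    allV : (k : ℕ) → (Fin k → Bool) → Bool
    allV zero    f = true
    allV (suc k) f = Data.Bool._∧_ (f zero) (allV k (λ i → f (suc i)))

subsets : (h : ℕ) → List (Vec Bool h)
subsets zero    = [] ∷ []
subsets (suc h) = map (true ∷_) (subsets h) ++ map (false ∷_) (subsets h)

size : {h : ℕ} → Vec Bool h → ℕ
size []      = 0
size (x ∷ T) = [ x ] + size T

countList : {A : Set} → (A → Bool) → List A → ℕ
countList P []       = 0
countList P (x ∷ xs) = [ P x ] + countList P xs

isEven : ℕ → Bool
isEven zero          = true
isEven (suc zero)    = false
isEven (suc (suc k)) = isEven k

EE : {G : Graph} {k h : ℕ} → SubMulti G k h → Orientation h → ℕ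
EE {h = h} H D = countList (λ T → Data.Bool._∧_ (eulerian? H D T) (isEven (size T))) (subsets h)

EO : {G : Graph} {k h : ℕ} → SubMulti G k h → Orientation h → ℕ
EO {h = h} H D = countList (λ T → Data.Bool._∧_ (eulerian? H D T) (Data.Bool.not (isEven (size T)))) (subsets h)

{-# OPTIONS --safe #-}

-- Give every edge e of G a value 1 + (a sum of 0/1 variables x_j over the copies j of e in H, suitably
-- reflected); it stays in [1, p-1].  The boundary at v is then an affine form in x with linear part flow v.
-- Multiply, over all v ≠ u, the p-1 forms (boundary − b)(v) + c with c = 1, …, p-1: a point x at which
-- this product is nonzero mod p solves the boundary equations off u, and the one at u follows by summation.
-- There are as many factors as variables, so the alternating sum of the product over {0,1}^h depends only
-- on the linear parts: it is a permanent.  Splitting each column into its tail and head entries, the permanent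
-- becomes a signed sum over the sets T of reversed edges, where T contributes ∏ outdeg(v)! if reversing T
-- preserves all out-degrees (T is Eulerian) and 0 otherwise.  So it equals ∏ outdeg(v)! (EE − EO), which is
-- nonzero mod p.
module Submission where

open import Defs
open import Data.Nat using (ℕ; _*_; _∸_; _≤_)
open import Data.Nat.Primality using (Prime)
open import Data.Integer using (+_; _-_)
open import Data.Integer.Divisibility using (_∣_)
open import Data.Fin using (Fin)
open import Data.Product using (Σ; _×_)
open import Relation.Nullary using (¬_)
open import Relation.Binary.PropositionalEquality using (_≡_; _≢_)

open import Data.Bool using (Bool; true; false; not; if_then_else_; _∧_; _xor_)
open import Data.Bool.Properties using (not-involutive)
open import Data.Fin using (zero; suc)
open import Data.Fin.Properties using (_≟_; suc-injective)
open import Data.Integer using (ℤ)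
import Data.Integer as ℤ
import Data.Integer.DivMod as ℤ
import Data.Integer.Divisibility.Signed as Signed
import Data.Integer.Properties as ℤ
open import Data.Integer.Tactic.RingSolver using (solve-∀)
open import Data.List using (List; []; _∷_; map; length; _++_; concat; tabulate; upTo)
open import Data.List.Membership.Propositional using (_∈_)
open import Data.List.Membership.Propositional.Properties using (∈-concat⁺′; ∈-tabulate⁺; ∈-map⁺; ∈-upTo⁺)
import Data.List.Properties as List
open import Data.List.Relation.Unary.Any using (here; there)
open import Data.Nat using (zero; suc; z≤n; s≤s; _<_; _!)
import Data.Nat as ℕ
import Data.Nat.Divisibility as ℕ
open import Data.Nat.Primality using (euclidsLemma; prime⇒nonTrivial)
import Data.Nat.Properties as ℕ
open import Data.Product using (_,_; proj₁; proj₂)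
open import Data.Sum using (inj₁; inj₂)
open import Data.Vec using (Vec; []; _∷_; lookup)
open import Function using (_∘_)
open import Relation.Binary.PropositionalEquality using (refl; sym; trans; cong; cong₂; subst; module ≡-Reasoning)
open import Relation.Nullary using (Dec; yes; no; does; contradiction)
open import Relation.Nullary.Decidable using (dec-true; dec-false)

-- Alternating sums over the Boolean cube.

-- An iterated finite difference: the sign of a point is the parity of its number of `true` entries,
-- and polynomials of degree below `h` in the variables are sent to 0.
alt : (h : ℕ) → (Vec Bool h → ℤ) → ℤ
alt zero    f = f []
alt (suc h) f = alt h (λ x → f (false ∷ x)) - alt h (λ x → f (true ∷ x))

alt-cong : ∀ h {f g : Vec Bool h → ℤ} → (∀ x → f x ≡ g x) → alt h f ≡ alt h g
alt-cong zero    eq = eq []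
alt-cong (suc h) eq = cong₂ _-_ (alt-cong h (λ x → eq (false ∷ x))) (alt-cong h (λ x → eq (true ∷ x)))

alt-+ : ∀ h (f g : Vec Bool h → ℤ) → alt h (λ x → f x ℤ.+ g x) ≡ alt h f ℤ.+ alt h g
alt-+ zero    f g = refl
alt-+ (suc h) f g = trans
  (cong₂ _-_ (alt-+ h (λ x → f (false ∷ x)) (λ x → g (false ∷ x))) (alt-+ h (λ x → f (true ∷ x)) (λ x → g (true ∷ x))))
  (interchange (alt h (λ x → f (false ∷ x))) (alt h (λ x → g (false ∷ x))) (alt h (λ x → f (true ∷ x))) (alt h (λ x → g (true ∷ x))))
  where
  interchange : ∀ a b c d → (a ℤ.+ b) - (c ℤ.+ d) ≡ (a - c) ℤ.+ (b - d)
  interchange = solve-∀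

alt-* : ∀ h c (f : Vec Bool h → ℤ) → alt h (λ x → c ℤ.* f x) ≡ c ℤ.* alt h f
alt-* zero    c f = refl
alt-* (suc h) c f = trans
  (cong₂ _-_ (alt-* h c (λ x → f (false ∷ x))) (alt-* h c (λ x → f (true ∷ x))))
  (factor c (alt h (λ x → f (false ∷ x))) (alt h (λ x → f (true ∷ x))))
  where
  factor : ∀ a b d → a ℤ.* b - a ℤ.* d ≡ a ℤ.* (b - d)
  factor = solve-∀

alt-- : ∀ h (f g : Vec Bool h → ℤ) → alt h (λ x → f x - g x) ≡ alt h f - alt h g
alt-- h f g = begin
  alt h (λ x → f x - g x)                        ≡⟨ alt-cong h (λ x → neg (f x) (g x)) ⟩
  alt h (λ x → f x ℤ.+ ℤ.-1ℤ ℤ.* g x)             ≡⟨ alt-+ h f _ ⟩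
  alt h f ℤ.+ alt h (λ x → ℤ.-1ℤ ℤ.* g x)         ≡⟨ cong (λ z → alt h f ℤ.+ z) (alt-* h ℤ.-1ℤ g) ⟩
  alt h f ℤ.+ ℤ.-1ℤ ℤ.* alt h g                   ≡⟨ neg (alt h f) (alt h g) ⟨
  alt h f - alt h g                              ∎
  where
  open ≡-Reasoning
  neg : ∀ a b → a - b ≡ a ℤ.+ ℤ.-1ℤ ℤ.* b
  neg a b = cong (λ z → a ℤ.+ z) (sym (ℤ.-1*i≡-i b))

alt-0 : ∀ h → alt h (λ _ → + 0) ≡ + 0
alt-0 zero    = refl
alt-0 (suc h) = ℤ.i≡j⇒i-j≡0 (refl {x = alt h (λ _ → + 0)})

-- The variable is 1 at `false`, the point that `alt` counts positively, so `alt` is a forward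
-- difference in each variable and the permanent arises without a sign.
linear : ∀ {h} → (Fin h → ℤ) → Vec Bool h → ℤ
linear {h} a x = Σℤ h (λ j → + [ not (lookup x j) ] ℤ.* a j)

-- Permanents and alternating sums of products of affine forms.

module _ {A : Set} where

  -- The derivation Σᵢ α(vᵢ) ∂/∂vᵢ, acting on functions of a word.
  ∂ : (A → ℤ) → (List A → ℤ) → List A → ℤ
  ∂ α Φ []       = + 0
  ∂ α Φ (v ∷ vs) = α v ℤ.* Φ vs ℤ.+ ∂ α (λ us → Φ (v ∷ us)) vs

  ∂-cong : ∀ {α β : A → ℤ} {Φ Ψ} → (∀ v → α v ≡ β v) → (∀ us → Φ us ≡ Ψ us) → ∀ vs → ∂ α Φ vs ≡ ∂ β Ψ vs
  ∂-cong α≡β Φ≡Ψ []       = refl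
  ∂-cong α≡β Φ≡Ψ (v ∷ vs) =
    cong₂ ℤ._+_ (cong₂ ℤ._*_ (α≡β v) (Φ≡Ψ vs)) (∂-cong α≡β (λ us → Φ≡Ψ (v ∷ us)) vs)

  ∂-- : ∀ (α β : A → ℤ) Φ vs → ∂ (λ v → α v - β v) Φ vs ≡ ∂ α Φ vs - ∂ β Φ vs
  ∂-- α β Φ []       = refl
  ∂-- α β Φ (v ∷ vs) = trans (cong (λ z → (α v - β v) ℤ.* Φ vs ℤ.+ z) (∂-- α β _ vs)) (distrib (α v) (β v) (Φ vs) (∂ α (λ us → Φ (v ∷ us)) vs) (∂ β (λ us → Φ (v ∷ us)) vs))
    where
    distrib : ∀ a b c d e → (a - b) ℤ.* c ℤ.+ (d - e) ≡ (a ℤ.* c ℤ.+ d) - (b ℤ.* c ℤ.+ e)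
    distrib = solve-∀

  ∂-alt : ∀ h α (Ψ : Vec Bool h → List A → ℤ) vs →
          ∂ α (λ us → alt h (λ T → Ψ T us)) vs ≡ alt h (λ T → ∂ α (Ψ T) vs)
  ∂-alt h α Ψ []       = sym (alt-0 h)
  ∂-alt h α Ψ (v ∷ vs) = trans
    (cong₂ ℤ._+_ (sym (alt-* h (α v) (λ T → Ψ T vs))) (∂-alt h α (λ T us → Ψ T (v ∷ us)) vs))
    (sym (alt-+ h _ _))

  -- The permanent of the matrix with rows a v (v in the word) and columns Fin h, expanded along columns.
  perm : (h : ℕ) → (A → Fin h → ℤ) → List A → ℤ
  perm zero    a []      = + 1
  perm zero    a (_ ∷ _) = + 0
  perm (suc h) a vs      = ∂ (λ v → a v zero) (perm h (λ v j → a v (suc j))) vs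

  perm-cong : ∀ h {a b : A → Fin h → ℤ} → (∀ v j → a v j ≡ b v j) → ∀ vs → perm h a vs ≡ perm h b vs
  perm-cong zero    a≡b []      = refl
  perm-cong zero    a≡b (_ ∷ _) = refl
  perm-cong (suc h) a≡b vs      = ∂-cong (λ v → a≡b v zero) (perm-cong h (λ v j → a≡b v (suc j))) vs

  -- The permanent is linear in each column; `T` records the columns that contribute `b`, each at
  -- the cost of one sign.
  perm-alt : ∀ h (a b : A → Fin h → ℤ) vs →
             perm h (λ v j → a v j - b v j) vs ≡
             alt h (λ T → perm h (λ v j → if lookup T j then b v j else a v j) vs)
  perm-alt zero    a b []      = refl
  perm-alt zero    a b (_ ∷ _) = refl
  perm-alt (suc h) a b vs      = begin
    ∂ (λ v → a v zero - b v zero) (perm h (λ v j → a v (suc j) - b v (suc j))) vs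
      ≡⟨ ∂-cong (λ _ → refl) (perm-alt h _ _) vs ⟩
    ∂ (λ v → a v zero - b v zero) (λ us → alt h (λ T → perm h (tailColumns T) us)) vs
      ≡⟨ ∂-- (λ v → a v zero) (λ v → b v zero) _ vs ⟩
    ∂ (λ v → a v zero) (λ us → alt h (λ T → perm h (tailColumns T) us)) vs -
    ∂ (λ v → b v zero) (λ us → alt h (λ T → perm h (tailColumns T) us)) vs
      ≡⟨ cong₂ _-_ (∂-alt h _ (λ T → perm h (tailColumns T)) vs) (∂-alt h _ (λ T → perm h (tailColumns T)) vs) ⟩
    alt h (λ T → ∂ (λ v → a v zero) (perm h (tailColumns T)) vs) -
    alt h (λ T → ∂ (λ v → b v zero) (perm h (tailColumns T)) vs) ∎
    where
    open ≡-Reasoning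
    tailColumns : Vec Bool h → A → Fin h → ℤ
    tailColumns T v j = if lookup T j then b v (suc j) else a v (suc j)

  affineProduct : ∀ {h} → (A → Fin h → ℤ) → Vec Bool h → List (A × ℤ) → ℤ
  affineProduct a x []             = + 1
  affineProduct a x ((v , c) ∷ cs) = (linear (a v) x ℤ.+ c) ℤ.* affineProduct a x cs

  -- The effect on the constants of giving the value 1 to a variable whose coefficients are `α`.
  shift : (A → ℤ) → List (A × ℤ) → List (A × ℤ)
  shift α = map (λ (v , c) → v , α v ℤ.+ c)

  affineProduct-true : ∀ {h} (a : A → Fin (suc h) → ℤ) x cs →
    affineProduct a (true ∷ x) cs ≡ affineProduct (λ v j → a v (suc j)) x cs
  affineProduct-true a x []             = refl
  affineProduct-true a x ((v , c) ∷ cs) = cong₂ ℤ._*_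
    (cong (λ z → z ℤ.+ c) (ℤ.+-identityˡ (linear (λ j → a v (suc j)) x)))
    (affineProduct-true a x cs)

  affineProduct-false : ∀ {h} (a : A → Fin (suc h) → ℤ) x cs →
    affineProduct a (false ∷ x) cs ≡ affineProduct (λ v j → a v (suc j)) x (shift (λ v → a v zero) cs)
  affineProduct-false a x []             = refl
  affineProduct-false a x ((v , c) ∷ cs) = cong₂ ℤ._*_ (assoc (a v zero) _ c) (affineProduct-false a x cs)
    where
    assoc : ∀ p q r → + 1 ℤ.* p ℤ.+ q ℤ.+ r ≡ q ℤ.+ (p ℤ.+ r)
    assoc = solve-∀

  -- ∏ (αᵢ + Lᵢ) − ∏ Lᵢ = Σᵢ αᵢ ∏_{j<i} (αⱼ + Lⱼ) ∏_{j>i} Lⱼ; the weight Q collects the factors j < i.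
  alt-telescope : ∀ h (a : A → Fin h → ℤ) (α : A → ℤ) (Q : Vec Bool h → ℤ) (Φ : List A → ℤ) cs →
    (∀ ds → length ds < length cs → alt h (λ x → Q x ℤ.* affineProduct a x ds) ≡ Φ (map proj₁ ds)) →
    alt h (λ x → Q x ℤ.* (affineProduct a x (shift α cs) - affineProduct a x cs)) ≡ ∂ α Φ (map proj₁ cs)
  alt-telescope h a α Q Φ []             hyp = trans (alt-cong h (λ x → ℤ.*-zeroʳ (Q x))) (alt-0 h)
  alt-telescope h a α Q Φ ((v , c) ∷ cs) hyp = begin
    alt h (λ x → Q x ℤ.* ((L x ℤ.+ (α v ℤ.+ c)) ℤ.* P′ x - (L x ℤ.+ c) ℤ.* P x))
      ≡⟨ alt-cong h (λ x → split (Q x) (L x) (α v) c (P′ x) (P x)) ⟩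
    alt h (λ x → α v ℤ.* (Q x ℤ.* P x) ℤ.+ Q′ x ℤ.* (P′ x - P x))
      ≡⟨ alt-+ h _ _ ⟩
    alt h (λ x → α v ℤ.* (Q x ℤ.* P x)) ℤ.+ alt h (λ x → Q′ x ℤ.* (P′ x - P x))
      ≡⟨ cong₂ ℤ._+_
           (trans (alt-* h (α v) _) (cong (α v ℤ.*_) (hyp cs ℕ.≤-refl)))
           (alt-telescope h a α Q′ (λ us → Φ (v ∷ us)) cs λ ds ds<cs →
              trans (alt-cong h (λ x → ℤ.*-assoc (Q x) _ _)) (hyp ((v , α v ℤ.+ c) ∷ ds) (s≤s ds<cs))) ⟩
    α v ℤ.* Φ (map proj₁ cs) ℤ.+ ∂ α (λ us → Φ (v ∷ us)) (map proj₁ cs) ∎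
    where
    open ≡-Reasoning
    L P P′ Q′ : Vec Bool h → ℤ
    L  x = linear (a v) x
    P  x = affineProduct a x cs
    P′ x = affineProduct a x (shift α cs)
    Q′ x = Q x ℤ.* (L x ℤ.+ (α v ℤ.+ c))
    split : ∀ q l s c p′ p → q ℤ.* ((l ℤ.+ (s ℤ.+ c)) ℤ.* p′ - (l ℤ.+ c) ℤ.* p) ≡
            s ℤ.* (q ℤ.* p) ℤ.+ q ℤ.* (l ℤ.+ (s ℤ.+ c)) ℤ.* (p′ - p)
    split = solve-∀

  -- The difference in the first variable is telescoped into `∂` along the first column, and one
  -- factor is lost. The bound is an inequality because the induction speaks of all shorter lists;
  -- with fewer factors than variables both sides are 0.
  alt-affineProduct : ∀ h (a : A → Fin h → ℤ) cs → length cs ≤ h →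
    alt h (λ x → affineProduct a x cs) ≡ perm h a (map proj₁ cs)
  alt-affineProduct zero    a []  _  = refl
  alt-affineProduct (suc h) a cs len = begin
    alt h (λ x → affineProduct a (false ∷ x) cs) - alt h (λ x → affineProduct a (true ∷ x) cs)
      ≡⟨ cong₂ _-_ (alt-cong h (λ x → affineProduct-false a x cs)) (alt-cong h (λ x → affineProduct-true a x cs)) ⟩
    alt h (λ x → affineProduct a′ x (shift α cs)) - alt h (λ x → affineProduct a′ x cs)
      ≡⟨ alt-- h _ _ ⟨
    alt h (λ x → affineProduct a′ x (shift α cs) - affineProduct a′ x cs)
      ≡⟨ alt-cong h (λ x → ℤ.*-identityˡ _) ⟨
    alt h (λ x → + 1 ℤ.* (affineProduct a′ x (shift α cs) - affineProduct a′ x cs))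
      ≡⟨ alt-telescope h a′ α (λ _ → + 1) (perm h a′) cs (λ ds ds<cs →
           trans (alt-cong h (λ x → ℤ.*-identityˡ _))
                 (alt-affineProduct h a′ ds (ℕ.≤-pred (ℕ.≤-trans ds<cs len)))) ⟩
    ∂ α (perm h a′) (map proj₁ cs) ∎
    where
    open ≡-Reasoning
    α = λ v → a v zero
    a′ = λ v j → a v (suc j)

-- Permanents of incidence matrices, and factorials modulo a prime.

δ : ∀ {n} → Fin n → Fin n → ℕ
δ x v = [ does (x ≟ v) ]

δ-refl : ∀ {n} (x : Fin n) → δ x x ≡ 1
δ-refl x = cong [_] (dec-true (x ≟ x) refl)

δ-≢ : ∀ {n} {x v : Fin n} → x ≢ v → δ x v ≡ 0
δ-≢ {x = x} {v} x≢v = cong [_] (dec-false (x ≟ v) x≢v)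

occ : ∀ {n} h → (Fin h → Fin n) → Fin n → ℕ
occ h w v = Σℕ h (λ j → δ (w j) v)

cnt : ∀ {n} → List (Fin n) → Fin n → ℕ
cnt []       v = 0
cnt (x ∷ vs) v = δ x v ℕ.+ cnt vs v

-- Only the positions that hold `x` contribute, each through the word with that occurrence deleted.
-- The hypothesis describes such words by multiplicities alone, so all these terms equal `κ`.
∂-indicator : ∀ {n} (x : Fin n) Φ κ vs →
  (∀ us → (∀ v → δ x v ℕ.+ cnt us v ≡ cnt vs v) → Φ us ≡ κ) →
  ∂ (λ v → + δ x v) Φ vs ≡ + cnt vs x ℤ.* κ
∂-indicator x Φ κ []       hyp = refl
∂-indicator x Φ κ (y ∷ vs) hyp = trans (cong (λ z → + δ x y ℤ.* Φ vs ℤ.+ z) tail-eq) head-eq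
  where
  swap : ∀ a b c → a ℕ.+ (b ℕ.+ c) ≡ b ℕ.+ (a ℕ.+ c)
  swap a b c = trans (sym (ℕ.+-assoc a b c)) (trans (cong (ℕ._+ c) (ℕ.+-comm a b)) (ℕ.+-assoc b a c))
  tail-eq : ∂ (λ v → + δ x v) (λ us → Φ (y ∷ us)) vs ≡ + cnt vs x ℤ.* κ
  tail-eq = ∂-indicator x (λ us → Φ (y ∷ us)) κ vs λ us us-eq →
    hyp (y ∷ us) λ v → trans (swap (δ x v) (δ y v) (cnt us v)) (cong (δ y v ℕ.+_) (us-eq v))
  collect : ∀ k c → + 1 ℤ.* k ℤ.+ c ℤ.* k ≡ (+ 1 ℤ.+ c) ℤ.* k
  collect = solve-∀
  head-eq : + δ x y ℤ.* Φ vs ℤ.+ + cnt vs x ℤ.* κ ≡ + (δ y x ℕ.+ cnt vs x) ℤ.* κ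
  head-eq with x ≟ y
  ... | yes refl rewrite hyp vs (λ _ → refl) | δ-refl x = collect κ (+ cnt vs x)
  ... | no x≢y rewrite δ-≢ (x≢y ∘ sym) = ℤ.+-identityˡ _

∏! : ∀ n → (Fin n → ℕ) → ℕ
∏! zero    k = 1
∏! (suc n) k = k zero ! * ∏! n (λ v → k (suc v))

∏!-0 : ∀ n → ∏! n (λ _ → 0) ≡ 1
∏!-0 zero    = refl
∏!-0 (suc n) = trans (ℕ.*-identityˡ _) (∏!-0 n)

∏!-cong : ∀ n {k l : Fin n → ℕ} → (∀ v → k v ≡ l v) → ∏! n k ≡ ∏! n l
∏!-cong zero    eq = refl
∏!-cong (suc n) eq = cong₂ (λ a b → a ! * b) (eq zero) (∏!-cong n (λ v → eq (suc v)))

∏!-suc : ∀ n x (k : Fin n → ℕ) → ∏! n (λ v → δ x v ℕ.+ k v) ≡ suc (k x) * ∏! n k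
∏!-suc (suc n) zero    k = ℕ.*-assoc (suc (k zero)) (k zero !) _
∏!-suc (suc n) (suc x) k = begin
  k zero ! * ∏! n (λ v → δ x v ℕ.+ k (suc v))          ≡⟨ cong (k zero ! *_) (∏!-suc n x (k ∘ suc)) ⟩
  k zero ! * (suc (k (suc x)) * ∏! n (k ∘ suc))        ≡⟨ ℕ.*-assoc (k zero !) _ _ ⟨
  k zero ! * suc (k (suc x)) * ∏! n (k ∘ suc)          ≡⟨ cong (_* ∏! n (k ∘ suc)) (ℕ.*-comm (k zero !) _) ⟩
  suc (k (suc x)) * (k zero !) * ∏! n (k ∘ suc)        ≡⟨ ℕ.*-assoc (suc (k (suc x))) (k zero !) _ ⟩
  suc (k (suc x)) * (k zero ! * ∏! n (k ∘ suc))        ∎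
  where open ≡-Reasoning

prime∤! : ∀ {p} → Prime p → ∀ m → m < p → ¬ p ℕ.∣ m !
prime∤! pp zero    m<p p∣1 = ℕ.<⇒≱ (ℕ.nonTrivial⇒n>1 _ {{prime⇒nonTrivial pp}}) (ℕ.∣⇒≤ p∣1)
prime∤! pp (suc m) m<p p∣m! with euclidsLemma (suc m) (m !) pp p∣m!
... | inj₁ p∣m = ℕ.<⇒≱ m<p (ℕ.∣⇒≤ p∣m)
... | inj₂ p∣! = prime∤! pp m (ℕ.<-trans (ℕ.n<1+n m) m<p) p∣!

prime∤∏! : ∀ {p} → Prime p → ∀ n k → (∀ v → k v < p) → ¬ p ℕ.∣ ∏! n k
prime∤∏! pp zero    k k<p p∣1 = prime∤! pp 0 (ℕ.<-trans (s≤s z≤n) (ℕ.nonTrivial⇒n>1 _ {{prime⇒nonTrivial pp}})) p∣1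
prime∤∏! pp (suc n) k k<p p∣∏ with euclidsLemma (k zero !) _ pp p∣∏
... | inj₁ p∣! = prime∤! pp (k zero) (k<p zero) p∣!
... | inj₂ p∣∏′ = prime∤∏! pp n (k ∘ suc) (k<p ∘ suc) p∣∏′

incidence : ∀ {n h} → (Fin h → Fin n) → Fin n → Fin h → ℤ
incidence w v j = + δ (w j) v

-- A nonzero term would match every column `j` with a row labelled `w j`, which forces equal
-- multiplicities.
perm-mismatch : ∀ {n} h (w : Fin h → Fin n) vs v → occ h w v ≢ cnt vs v → perm h (incidence w) vs ≡ + 0
perm-mismatch zero    w []      v occ≢cnt = contradiction refl occ≢cnt
perm-mismatch zero    w (_ ∷ _) v occ≢cnt = refl
perm-mismatch (suc h) w vs      v occ≢cnt = trans
  (∂-indicator (w zero) (perm h (incidence (w ∘ suc))) (+ 0) vs λ us us-eq →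
     perm-mismatch h (w ∘ suc) us v λ eq → occ≢cnt (trans (cong (δ (w zero) v ℕ.+_) eq) (us-eq v)))
  (ℤ.*-zeroʳ (+ cnt vs (w zero)))

-- The columns with `w j` equal to `v` can be matched with the rows labelled `v` in any order,
-- independently for each `v`; hence a product of factorials.
perm-match : ∀ {n} h (w : Fin h → Fin n) vs → (∀ v → occ h w v ≡ cnt vs v) →
             perm h (incidence w) vs ≡ + ∏! n (occ h w)
perm-match {n} zero w []      occ≡cnt = cong +_ (sym (∏!-0 n))
perm-match     zero w (x ∷ vs) occ≡cnt with () ← trans (occ≡cnt x) (cong (ℕ._+ cnt vs x) (δ-refl x))
perm-match {n} (suc h) w vs   occ≡cnt = begin
  ∂ (λ v → + δ x v) (perm h (incidence w′)) vs
    ≡⟨ ∂-indicator x _ (+ ∏! n (occ h w′)) vs (λ us us-eq →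
         perm-match h w′ us λ v → ℕ.+-cancelˡ-≡ (δ x v) _ _ (trans (occ≡cnt v) (sym (us-eq v)))) ⟩
  + cnt vs x ℤ.* + ∏! n (occ h w′)
    ≡⟨ cong (λ c → + c ℤ.* + ∏! n (occ h w′)) (trans (sym (occ≡cnt x)) (cong (ℕ._+ occ h w′ x) (δ-refl x))) ⟩
  + suc (occ h w′ x) ℤ.* + ∏! n (occ h w′)
    ≡⟨ ℤ.pos-* (suc (occ h w′ x)) _ ⟨
  + (suc (occ h w′ x) * ∏! n (occ h w′))
    ≡⟨ cong +_ (∏!-suc n x (occ h w′)) ⟨
  + ∏! n (occ (suc h) w) ∎
  where
  open ≡-Reasoning
  x = w zero
  w′ = w ∘ suc

-- Even and odd counts as an alternating sum.

countList-++ : ∀ {A : Set} (P : A → Bool) xs ys → countList P (xs ++ ys) ≡ countList P xs ℕ.+ countList P ys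
countList-++ P []       ys = refl
countList-++ P (x ∷ xs) ys = trans (cong ([ P x ] ℕ.+_) (countList-++ P xs ys)) (sym (ℕ.+-assoc [ P x ] _ _))

countList-map : ∀ {A B : Set} (P : B → Bool) (f : A → B) xs → countList P (map f xs) ≡ countList (P ∘ f) xs
countList-map P f []       = refl
countList-map P f (x ∷ xs) = cong ([ P (f x) ] ℕ.+_) (countList-map P f xs)

countList-cong : ∀ {A : Set} {P Q : A → Bool} → (∀ x → P x ≡ Q x) → ∀ xs → countList P xs ≡ countList Q xs
countList-cong eq []       = refl
countList-cong eq (x ∷ xs) = cong₂ (λ a b → [ a ] ℕ.+ b) (eq x) (countList-cong eq xs)

countList-subsets : ∀ h (P : Vec Bool (suc h) → Bool) →
  countList P (subsets (suc h)) ≡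
  countList (λ T → P (true ∷ T)) (subsets h) ℕ.+ countList (λ T → P (false ∷ T)) (subsets h)
countList-subsets h P = trans (countList-++ P (map (true ∷_) (subsets h)) (map (false ∷_) (subsets h)))
  (cong₂ ℕ._+_ (countList-map P (true ∷_) (subsets h)) (countList-map P (false ∷_) (subsets h)))

isEven-suc : ∀ k → isEven (suc k) ≡ not (isEven k)
isEven-suc zero          = refl
isEven-suc (suc zero)    = refl
isEven-suc (suc (suc k)) = isEven-suc k

-- Prepending `true` flips both the sign in `alt` and the parity of the size, so the even and odd
-- counts of that half trade places.
alt-count : ∀ h (e : Vec Bool h → Bool) →
  alt h (λ T → + [ e T ]) ≡
  + countList (λ T → e T ∧ isEven (size T)) (subsets h) -
  + countList (λ T → e T ∧ not (isEven (size T))) (subsets h)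
alt-count zero e with e []
... | true  = refl
... | false = refl
alt-count (suc h) e = begin
  alt h (λ T → + [ e (false ∷ T) ]) - alt h (λ T → + [ e (true ∷ T) ])
    ≡⟨ cong₂ _-_ (alt-count h (λ T → e (false ∷ T))) (alt-count h (λ T → e (true ∷ T))) ⟩
  (+ even false - + odd false) - (+ even true - + odd true)
    ≡⟨ regroup (+ even false) (+ odd false) (+ even true) (+ odd true) ⟩
  + (odd true ℕ.+ even false) - + (even true ℕ.+ odd false)
    ≡⟨ cong₂ (λ a b → + (a ℕ.+ even false) - + (b ℕ.+ odd false))
         (countList-cong (λ T → cong (e (true ∷ T) ∧_) (sym (isEven-suc (size T)))) (subsets h))
         (countList-cong (λ T → cong (e (true ∷ T) ∧_)
            (trans (sym (not-involutive _)) (cong not (sym (isEven-suc (size T)))))) (subsets h)) ⟩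
  + (countList (λ T → e (true ∷ T) ∧ isEven (suc (size T))) (subsets h) ℕ.+ even false) -
  + (countList (λ T → e (true ∷ T) ∧ not (isEven (suc (size T)))) (subsets h) ℕ.+ odd false)
    ≡⟨ cong₂ (λ a b → + a - + b)
         (countList-subsets h (λ T → e T ∧ isEven (size T)))
         (countList-subsets h (λ T → e T ∧ not (isEven (size T)))) ⟨
  + countList (λ T → e T ∧ isEven (size T)) (subsets (suc h)) -
  + countList (λ T → e T ∧ not (isEven (size T))) (subsets (suc h)) ∎
  where
  open ≡-Reasoning
  even odd : Bool → ℕ
  even b = countList (λ T → e (b ∷ T) ∧ isEven (size T)) (subsets h)
  odd  b = countList (λ T → e (b ∷ T) ∧ not (isEven (size T))) (subsets h)
  regroup : ∀ a b c d → (a - b) - (c - d) ≡ (d ℤ.+ a) - (c ℤ.+ b)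
  regroup = solve-∀

-- Finite sums.

Σℤ-cong : ∀ k {f g : Fin k → ℤ} → (∀ i → f i ≡ g i) → Σℤ k f ≡ Σℤ k g
Σℤ-cong zero    eq = refl
Σℤ-cong (suc k) eq = cong₂ ℤ._+_ (eq zero) (Σℤ-cong k (λ i → eq (suc i)))

Σℤ-0 : ∀ k → Σℤ k (λ _ → + 0) ≡ + 0
Σℤ-0 zero    = refl
Σℤ-0 (suc k) = trans (ℤ.+-identityˡ _) (Σℤ-0 k)

Σℤ-+ : ∀ k (f g : Fin k → ℤ) → Σℤ k (λ i → f i ℤ.+ g i) ≡ Σℤ k f ℤ.+ Σℤ k g
Σℤ-+ zero    f g = refl
Σℤ-+ (suc k) f g = trans (cong (λ z → f zero ℤ.+ g zero ℤ.+ z) (Σℤ-+ k (f ∘ suc) (g ∘ suc)))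
  (interchange (f zero) (g zero) (Σℤ k (f ∘ suc)) (Σℤ k (g ∘ suc)))
  where
  interchange : ∀ a b c d → a ℤ.+ b ℤ.+ (c ℤ.+ d) ≡ (a ℤ.+ c) ℤ.+ (b ℤ.+ d)
  interchange = solve-∀

Σℤ-- : ∀ k (f g : Fin k → ℤ) → Σℤ k (λ i → f i - g i) ≡ Σℤ k f - Σℤ k g
Σℤ-- zero    f g = refl
Σℤ-- (suc k) f g = trans (cong (λ z → f zero - g zero ℤ.+ z) (Σℤ-- k (f ∘ suc) (g ∘ suc)))
  (interchange (f zero) (g zero) (Σℤ k (f ∘ suc)) (Σℤ k (g ∘ suc)))
  where
  interchange : ∀ a b c d → a - b ℤ.+ (c - d) ≡ (a ℤ.+ c) - (b ℤ.+ d)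
  interchange = solve-∀

Σℤ-* : ∀ k c (f : Fin k → ℤ) → Σℤ k (λ i → c ℤ.* f i) ≡ c ℤ.* Σℤ k f
Σℤ-* zero    c f = sym (ℤ.*-zeroʳ c)
Σℤ-* (suc k) c f = trans (cong (λ z → c ℤ.* f zero ℤ.+ z) (Σℤ-* k c (f ∘ suc)))
  (sym (ℤ.*-distribˡ-+ c (f zero) (Σℤ k (f ∘ suc))))

Σℤ-swap : ∀ k l (f : Fin k → Fin l → ℤ) →
          Σℤ k (λ i → Σℤ l (f i)) ≡ Σℤ l (λ j → Σℤ k (λ i → f i j))
Σℤ-swap zero    l f = sym (Σℤ-0 l)
Σℤ-swap (suc k) l f = trans (cong (λ z → Σℤ l (f zero) ℤ.+ z) (Σℤ-swap k l (f ∘ suc)))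
  (sym (Σℤ-+ l (f zero) _))

Σℤ-δ : ∀ k (x : Fin k) (f : Fin k → ℤ) → Σℤ k (λ i → + δ x i ℤ.* f i) ≡ f x
Σℤ-δ (suc k) zero    f = trans
  (cong₂ ℤ._+_ (ℤ.*-identityˡ (f zero)) (Σℤ-0 k))
  (ℤ.+-identityʳ (f zero))
Σℤ-δ (suc k) (suc x) f = trans (ℤ.+-identityˡ _) (Σℤ-δ k x (f ∘ suc))

-- Lets identities between sums in ℕ be inherited from ℤ, since `+_` is injective.
pos-Σ : ∀ k (f : Fin k → ℕ) → + Σℕ k f ≡ Σℤ k (λ i → + f i)
pos-Σ zero    f = refl
pos-Σ (suc k) f = cong (λ z → + f zero ℤ.+ z) (pos-Σ k (f ∘ suc))

Σℕ-cong : ∀ k {f g : Fin k → ℕ} → (∀ i → f i ≡ g i) → Σℕ k f ≡ Σℕ k g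
Σℕ-cong zero    eq = refl
Σℕ-cong (suc k) eq = cong₂ ℕ._+_ (eq zero) (Σℕ-cong k (λ i → eq (suc i)))

Σℕ-mono : ∀ k {f g : Fin k → ℕ} → (∀ i → f i ≤ g i) → Σℕ k f ≤ Σℕ k g
Σℕ-mono zero    f≤g = z≤n
Σℕ-mono (suc k) f≤g = ℕ.+-mono-≤ (f≤g zero) (Σℕ-mono k (λ i → f≤g (suc i)))

Σℕ-const : ∀ k {c} {f : Fin k → ℕ} → (∀ i → f i ≡ c) → Σℕ k f ≡ k * c
Σℕ-const zero    eq = refl
Σℕ-const (suc k) eq = cong₂ ℕ._+_ (eq zero) (Σℕ-const k (λ i → eq (suc i)))

Σℕ-+ : ∀ k (f g : Fin k → ℕ) → Σℕ k (λ i → f i ℕ.+ g i) ≡ Σℕ k f ℕ.+ Σℕ k g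
Σℕ-+ k f g = ℤ.+-injective (begin
  + Σℕ k (λ i → f i ℕ.+ g i)                 ≡⟨ pos-Σ k _ ⟩
  Σℤ k (λ i → + f i ℤ.+ + g i)               ≡⟨ Σℤ-+ k _ _ ⟩
  Σℤ k (λ i → + f i) ℤ.+ Σℤ k (λ i → + g i)  ≡⟨ cong₂ ℤ._+_ (pos-Σ k f) (pos-Σ k g) ⟨
  + (Σℕ k f ℕ.+ Σℕ k g)                      ∎)
  where open ≡-Reasoning

Σℕ-swap : ∀ k l (f : Fin k → Fin l → ℕ) →
          Σℕ k (λ i → Σℕ l (f i)) ≡ Σℕ l (λ j → Σℕ k (λ i → f i j))
Σℕ-swap k l f = ℤ.+-injective (begin
  + Σℕ k (λ i → Σℕ l (f i))              ≡⟨ trans (pos-Σ k _) (Σℤ-cong k (λ i → pos-Σ l (f i))) ⟩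
  Σℤ k (λ i → Σℤ l (λ j → + f i j))      ≡⟨ Σℤ-swap k l _ ⟩
  Σℤ l (λ j → Σℤ k (λ i → + f i j))      ≡⟨ trans (pos-Σ l _) (Σℤ-cong l (λ j → pos-Σ k (λ i → f i j))) ⟨
  + Σℕ l (λ j → Σℕ k (λ i → f i j))      ∎)
  where open ≡-Reasoning

Σℕ-δ : ∀ k (x : Fin k) (f : Fin k → ℕ) → Σℕ k (λ i → δ x i * f i) ≡ f x
Σℕ-δ k x f = ℤ.+-injective (trans (pos-Σ k _)
  (trans (Σℤ-cong k (λ i → ℤ.pos-* (δ x i) (f i))) (Σℤ-δ k x (λ i → + f i))))

Σδ≡1 : ∀ k (x : Fin k) → Σℕ k (δ x) ≡ 1
Σδ≡1 k x = trans (Σℕ-cong k (λ i → sym (ℕ.*-identityʳ (δ x i)))) (Σℕ-δ k x (λ _ → 1))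

Σℕ-except : ∀ k {c} (u : Fin k) (f : Fin k → ℕ) → (∀ v → v ≢ u → f v ≡ c) → Σℕ k f ≡ f u ℕ.+ c * (k ∸ 1)
Σℕ-except (suc k) {c} zero f eq =
  cong (f zero ℕ.+_) (trans (Σℕ-const k (λ i → eq (suc i) λ ())) (ℕ.*-comm k c))
Σℕ-except (suc (suc k)) {c} (suc u) f eq = begin
  f zero ℕ.+ Σℕ (suc k) (f ∘ suc)      ≡⟨ cong₂ ℕ._+_ (eq zero λ ()) (Σℕ-except (suc k) u (f ∘ suc) (λ v v≢u → eq (suc v) (v≢u ∘ suc-injective))) ⟩
  c ℕ.+ (f (suc u) ℕ.+ c * k)          ≡⟨ ℕ.+-assoc c _ _ ⟨
  c ℕ.+ f (suc u) ℕ.+ c * k            ≡⟨ cong (ℕ._+ c * k) (ℕ.+-comm c _) ⟩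
  f (suc u) ℕ.+ c ℕ.+ c * k            ≡⟨ ℕ.+-assoc (f (suc u)) c _ ⟩
  f (suc u) ℕ.+ (c ℕ.+ c * k)          ≡⟨ cong (f (suc u) ℕ.+_) (ℕ.*-suc c k) ⟨
  f (suc u) ℕ.+ c * suc k              ∎
  where open ≡-Reasoning

-- Counting the copies of an edge.

[]≤1 : ∀ b → [ b ] ≤ 1
[]≤1 true  = s≤s z≤n
[]≤1 false = z≤n

δ-sym : ∀ {n} (x y : Fin n) → δ x y ≡ δ y x
δ-sym x y with x ≟ y
... | yes refl = sym (δ-refl x)
... | no x≢y   = sym (δ-≢ (x≢y ∘ sym))

δ≢0⇒≡ : ∀ {n} (x y : Fin n) → δ x y ≢ 0 → x ≡ y
δ≢0⇒≡ x y δ≢0 with x ≟ y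
... | yes x≡y = x≡y
... | no _    = contradiction refl δ≢0

Σℕ≤1 : ∀ k (f : Fin k → ℕ) → (∀ i → f i ≤ 1) → (∀ i j → f i ≢ 0 → f j ≢ 0 → i ≡ j) → Σℕ k f ≤ 1
Σℕ≤1 zero    f f≤1 unique = z≤n
Σℕ≤1 (suc k) f f≤1 unique with f zero ℕ.≟ 0
... | yes f0≡0 rewrite f0≡0 =
  Σℕ≤1 k (f ∘ suc) (f≤1 ∘ suc) (λ i j fi fj → suc-injective (unique (suc i) (suc j) fi fj))
... | no  f0≢0 = subst (_≤ 1) (sym (trans (cong (f zero ℕ.+_) rest≡0) (ℕ.+-identityʳ _))) (f≤1 zero)
  where
  fsuc≡0 : ∀ i → f (suc i) ≡ 0
  fsuc≡0 i with f (suc i) ℕ.≟ 0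
  ... | yes fi≡0 = fi≡0
  ... | no  fi≢0 with () ← unique zero (suc i) f0≢0 fi≢0
  rest≡0 : Σℕ k (f ∘ suc) ≡ 0
  rest≡0 = trans (Σℕ-const k fsuc≡0) (ℕ.*-zeroʳ k)

-- Sort the edges of `H` over `e` by copy index: by `injective`, each of the `k` indices occurs at
-- most once.
copies≤ : ∀ {G k h} (H : SubMulti G k h) e → Σℕ h (λ j → δ (orig H j) e) ≤ k
copies≤ {G} {k} {h} H e = begin
  Σℕ h (λ j → δ (orig H j) e)
    ≡⟨ Σℕ-cong h (λ j → sym (Σℕ-δ k (copy H j) (λ _ → δ (orig H j) e))) ⟩
  Σℕ h (λ j → Σℕ k (λ c → δ (copy H j) c * δ (orig H j) e))
    ≡⟨ Σℕ-swap h k _ ⟩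
  Σℕ k (λ c → Σℕ h (λ j → δ (copy H j) c * δ (orig H j) e))
    ≤⟨ Σℕ-mono k (λ c → Σℕ≤1 h _ (λ j → ℕ.*-mono-≤ ([]≤1 (does (copy H j ≟ c))) ([]≤1 (does (orig H j ≟ e)))) (unique c)) ⟩
  Σℕ k (λ _ → 1)
    ≡⟨ trans (Σℕ-const k (λ _ → refl)) (ℕ.*-identityʳ k) ⟩
  k ∎
  where
  open ℕ.≤-Reasoning
  both : ∀ c j → δ (copy H j) c * δ (orig H j) e ≢ 0 → copy H j ≡ c × orig H j ≡ e
  both c j ≢0 = δ≢0⇒≡ _ _ (λ eq → ≢0 (cong (_* δ (orig H j) e) eq)) ,
                δ≢0⇒≡ _ _ (λ eq → ≢0 (trans (cong (δ (copy H j) c *_) eq) (ℕ.*-zeroʳ (δ (copy H j) c))))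
  unique : ∀ c i j → δ (copy H i) c * δ (orig H i) e ≢ 0 → δ (copy H j) c * δ (orig H j) e ≢ 0 → i ≡ j
  unique c i j i≢0 j≢0 with both c i i≢0 | both c j j≢0
  ... | ci , oi | cj , oj = injective H i j (trans oi (sym oj)) (trans ci (sym cj))

-- Eulerian subgraphs and reversal of edges.

allFin? : (k : ℕ) → (Fin k → Bool) → Bool
allFin? zero    f = true
allFin? (suc k) f = f zero ∧ allFin? k (λ i → f (suc i))

allFin?-true : ∀ k {f} → allFin? k f ≡ true → ∀ i → f i ≡ true
allFin?-true (suc k) {f} eq i with f zero in f0
allFin?-true (suc k) eq zero    | true = f0
allFin?-true (suc k) eq (suc i) | true = allFin?-true k eq i

allFin?-false : ∀ k {f} → allFin? k f ≡ false → Σ (Fin k) λ i → f i ≡ false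
allFin?-false (suc k) {f} eq with f zero in f0
... | false = zero , f0
... | true  = let i , fi = allFin?-false k eq in suc i , fi

does-true : ∀ {A : Set} (A? : Dec A) → does A? ≡ true → A
does-true (yes a) _ = a

does-false : ∀ {A : Set} (A? : Dec A) → does A? ≡ false → ¬ A
does-false (no ¬a) _ = ¬a

module _ {G : Graph} {k h : ℕ} (H : SubMulti G k h) (D : Orientation h) (T : Vec Bool h) where

  balanced? : Fin (n G) → Bool
  balanced? v = does (outdegIn H D T v ℕ.≟ indegIn H D T v)

  -- The conjunction inside eulerian? has no name outside Defs: its occurrence here is the hole in
  -- the type of conjunction≡, filled by unification once the vertex count and the predicate are variables.
  mutual
    eulerian?≡ : eulerian? H D T ≡ allFin? (n G) balanced?
    eulerian?≡ with n G | balanced?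
    ... | l | f = conjunction≡ l f

    conjunction≡ : ∀ l (f : Fin l → Bool) → _ ≡ allFin? l f
    conjunction≡ zero    f = refl
    conjunction≡ (suc l) f = cong (f zero ∧_) (conjunction≡ l (λ i → f (suc i)))

  -- The tail map after reversing the edges of `T`, so that `occ h reversed` gives the new
  -- out-degrees.
  reversed : Fin h → Fin (n G)
  reversed j = if lookup T j then dhead H D j else dtail H D j

  -- Reversal trades the out-edges of `T` at `v` for its in-edges; both sides are sums to avoid
  -- truncated subtraction.
  outdeg-reversed : ∀ v → occ h reversed v ℕ.+ outdegIn H D T v ≡ outdeg H D v ℕ.+ indegIn H D T v
  outdeg-reversed v = trans (sym (Σℕ-+ h _ _)) (trans (Σℕ-cong h edge) (Σℕ-+ h _ _))
    where
    edge : ∀ j → δ (reversed j) v ℕ.+ [ lookup T j ] * δ (dtail H D j) v ≡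
                 δ (dtail H D j) v ℕ.+ [ lookup T j ] * δ (dhead H D j) v
    edge j with lookup T j
    ... | false = refl
    ... | true  = begin
      δ (dhead H D j) v ℕ.+ (δ (dtail H D j) v ℕ.+ 0)  ≡⟨ cong (δ (dhead H D j) v ℕ.+_) (ℕ.+-identityʳ _) ⟩
      δ (dhead H D j) v ℕ.+ δ (dtail H D j) v          ≡⟨ ℕ.+-comm (δ (dhead H D j) v) _ ⟩
      δ (dtail H D j) v ℕ.+ δ (dhead H D j) v          ≡⟨ cong (δ (dtail H D j) v ℕ.+_) (ℕ.+-identityʳ _) ⟨
      δ (dtail H D j) v ℕ.+ (δ (dhead H D j) v ℕ.+ 0)  ∎
      where open ≡-Reasoning

  -- By `outdeg-reversed`, `T` is Eulerian exactly when reversing it keeps all out-degrees. Then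
  -- rows and columns match; otherwise an unbalanced vertex witnesses a mismatch.
  perm-reversed : ∀ vs → (∀ v → cnt vs v ≡ outdeg H D v) →
    perm h (incidence reversed) vs ≡ + ∏! (n G) (outdeg H D) ℤ.* + [ eulerian? H D T ]
  perm-reversed vs cnt≡ with eulerian? H D T in eq
  ... | true = trans
    (perm-match h reversed vs (λ v → trans (occ≡ v) (sym (cnt≡ v))))
    (trans (cong +_ (∏!-cong (n G) occ≡)) (sym (ℤ.*-identityʳ _)))
    where
    occ≡ : ∀ v → occ h reversed v ≡ outdeg H D v
    occ≡ v = ℕ.+-cancelʳ-≡ (outdegIn H D T v) _ _ (trans (outdeg-reversed v) (cong (outdeg H D v ℕ.+_)
      (sym (does-true (_ ℕ.≟ _) (allFin?-true (n G) (trans (sym eulerian?≡) eq) v)))))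
  ... | false with allFin?-false (n G) (trans (sym eulerian?≡) eq)
  ...   | v , unbalanced = trans
    (perm-mismatch h reversed vs v (λ occ≡ → does-false (_ ℕ.≟ _) unbalanced
      (ℕ.+-cancelˡ-≡ (outdeg H D v) _ _ (trans (cong (ℕ._+ outdegIn H D T v) (sym (trans occ≡ (cnt≡ v)))) (outdeg-reversed v)))))
    (sym (ℤ.*-zeroʳ (+ ∏! (n G) (outdeg H D))))

module _ {G : Graph} {k h : ℕ} (H : SubMulti G k h) (D : Orientation h) where

  flow : Fin (n G) → Fin h → ℤ
  flow v j = incidence (dtail H D) v j - incidence (dhead H D) v j

  -- Taking the head entry in the columns of `T` and the tail entry elsewhere yields the incidence
  -- matrix of `reversed`; the signs of these choices turn the count into even minus odd.
  perm-flow : ∀ vs → (∀ v → cnt vs v ≡ outdeg H D v) →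
    perm h flow vs ≡ + ∏! (n G) (outdeg H D) ℤ.* (+ EE H D - + EO H D)
  perm-flow vs cnt≡ = begin
    perm h flow vs
      ≡⟨ perm-alt h (incidence (dtail H D)) (incidence (dhead H D)) vs ⟩
    alt h (λ T → perm h (λ v j → if lookup T j then incidence (dhead H D) v j else incidence (dtail H D) v j) vs)
      ≡⟨ alt-cong h (λ T → trans (perm-cong h (select T) vs) (perm-reversed H D T vs cnt≡)) ⟩
    alt h (λ T → + ∏! (n G) (outdeg H D) ℤ.* + [ eulerian? H D T ])
      ≡⟨ alt-* h (+ ∏! (n G) (outdeg H D)) _ ⟩
    + ∏! (n G) (outdeg H D) ℤ.* alt h (λ T → + [ eulerian? H D T ])
      ≡⟨ cong (λ z → + ∏! (n G) (outdeg H D) ℤ.* z) (alt-count h (eulerian? H D)) ⟩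
    + ∏! (n G) (outdeg H D) ℤ.* (+ EE H D - + EO H D) ∎
    where
    open ≡-Reasoning
    select : ∀ T v j → (if lookup T j then incidence (dhead H D) v j else incidence (dtail H D) v j) ≡
                       incidence (reversed H D T) v j
    select T v j with lookup T j
    ... | true  = refl
    ... | false = refl

-- Divisibility: nonvanishing points and residues.

-- Divisibility is decidable, so the point is found by descent: if the `false` half is divisible,
-- the `true` half cannot be.
∣-alt : ∀ {p} h {f : Vec Bool h → ℤ} → ¬ (p Signed.∣ alt h f) → Σ (Vec Bool h) λ x → ¬ (p Signed.∣ f x)
∣-alt zero ∤ = [] , ∤
∣-alt {p} (suc h) {f} ∤ with p Signed.∣? alt h (λ x → f (false ∷ x))
... | no  ∤₀ = let x , ∤fx = ∣-alt h ∤₀ in false ∷ x , ∤fx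
... | yes ∣₀ = let x , ∤fx = ∣-alt h (λ ∣₁ → ∤ (Signed.∣m∣n⇒∣m-n ∣₀ ∣₁)) in true ∷ x , ∤fx

∣-factor : ∀ {p h} {A : Set} (a : A → Fin h → ℤ) x {v c cs} → (v , c) ∈ cs →
           p Signed.∣ linear (a v) x ℤ.+ c → p Signed.∣ affineProduct a x cs
∣-factor a x {cs = _ ∷ cs} (here refl) p∣ = Signed.∣m⇒∣m*n (affineProduct a x cs) p∣
∣-factor a x {cs = (w , d) ∷ _} (there vc∈) p∣ = Signed.∣n⇒∣m*n (linear (a w) x ℤ.+ d) (∣-factor a x vc∈ p∣)

-- A nonzero remainder of `t` would be cancelled by one of the shifts 1, ..., p - 1.
residue : ∀ p .{{_ : ℕ.NonZero p}} t → (∀ i → i < p ∸ 1 → ¬ (+ p Signed.∣ t ℤ.+ + suc i)) → + p Signed.∣ t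
residue p@(suc q) t ∤ with t ℤ.%ℕ p in r≡ | ℤ.n%ℕd<d t p | ℤ.a≡a%ℕn+[a/ℕn]*n t p
... | zero  | _         | t≡ = Signed.divides (t ℤ./ℕ p) (trans t≡ (ℤ.+-identityˡ _))
-- For remainder `suc r` the cancelling shift is p - (r + 1), which is `suc (q ∸ suc r)`.
... | suc r | s≤s r<q | t≡ = contradiction (Signed.divides (t ℤ./ℕ p ℤ.+ + 1) (begin
  t ℤ.+ + suc (q ∸ suc r)                                       ≡⟨ cong (λ z → z ℤ.+ + suc (q ∸ suc r)) t≡ ⟩
  + suc r ℤ.+ t ℤ./ℕ p ℤ.* + p ℤ.+ + suc (q ∸ suc r)            ≡⟨ rearrange (+ suc r) (t ℤ./ℕ p ℤ.* + p) (+ suc (q ∸ suc r)) ⟩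
  t ℤ./ℕ p ℤ.* + p ℤ.+ + (suc r ℕ.+ suc (q ∸ suc r))            ≡⟨ cong (λ z → t ℤ./ℕ p ℤ.* + p ℤ.+ + z) (trans (ℕ.+-suc (suc r) _) (cong suc (ℕ.m+[n∸m]≡n r<q))) ⟩
  t ℤ./ℕ p ℤ.* + p ℤ.+ + p                                      ≡⟨ factor (t ℤ./ℕ p) (+ p) ⟩
  (t ℤ./ℕ p ℤ.+ + 1) ℤ.* + p                                    ∎))
  (∤ (q ∸ suc r) (ℕ.∸-monoʳ-< (s≤s z≤n) r<q))
  where
  open ≡-Reasoning
  rearrange : ∀ a b c → a ℤ.+ b ℤ.+ c ≡ b ℤ.+ (a ℤ.+ c)
  rearrange = solve-∀
  factor : ∀ a b → a ℤ.* b ℤ.+ b ≡ (a ℤ.+ + 1) ℤ.* b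
  factor = solve-∀

∣-Σ : ∀ {p} k {g : Fin k → ℤ} → (∀ i → p Signed.∣ g i) → p Signed.∣ Σℤ k g
∣-Σ zero    ∣g = Signed.divides (+ 0) refl
∣-Σ (suc k) ∣g = Signed.∣m∣n⇒∣m+n (∣g zero) (∣-Σ k (λ i → ∣g (suc i)))

∣-Σ-except : ∀ {p} k (u : Fin k) {g : Fin k → ℤ} → p Signed.∣ Σℤ k g →
             (∀ v → v ≢ u → p Signed.∣ g v) → p Signed.∣ g u
∣-Σ-except (suc k) zero    ∣Σ ∣g = Signed.∣m+n∣n⇒∣m ∣Σ (∣-Σ k (λ i → ∣g (suc i) λ ()))
∣-Σ-except (suc k) (suc u) ∣Σ ∣g = ∣-Σ-except k u (Signed.∣m+n∣m⇒∣n ∣Σ (∣g zero λ ()))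
  (λ v v≢u → ∣g (suc v) (v≢u ∘ suc-injective))

-- The list of affine factors.

cnt-++ : ∀ {n} (us vs : List (Fin n)) v → cnt (us ++ vs) v ≡ cnt us v ℕ.+ cnt vs v
cnt-++ []       vs v = refl
cnt-++ (x ∷ us) vs v = trans (cong (δ x v ℕ.+_) (cnt-++ us vs v)) (sym (ℕ.+-assoc (δ x v) _ _))

-- The multiplicity `k v` will be the out-degree of `v`: the row labels then match the out-degrees,
-- and a vertex of out-degree 0 yields no factor.
forms : ∀ {n} → (Fin n → ℕ) → (Fin n → ℤ) → List (Fin n × ℤ)
forms k d = concat (tabulate (λ v → map (λ i → v , d v ℤ.+ + suc i) (upTo (k v))))

∈-forms : ∀ {n} (k : Fin n → ℕ) d v {i} → i < k v → (v , d v ℤ.+ + suc i) ∈ forms k d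
∈-forms k d v i<k = ∈-concat⁺′ (∈-map⁺ _ (∈-upTo⁺ i<k)) (∈-tabulate⁺ v)

cnt-forms : ∀ {n} (k : Fin n → ℕ) d v → cnt (map proj₁ (forms k d)) v ≡ k v
cnt-forms {n} k d v = begin
  cnt (map proj₁ (forms k d)) v
    ≡⟨ cnt-concat n _ ⟩
  Σℕ n (λ x → cnt (map proj₁ (map (λ i → x , d x ℤ.+ + suc i) (upTo (k x)))) v)
    ≡⟨ Σℕ-cong n (λ x → trans (cnt-block x _ (upTo (k x))) (cong (δ v x *_) (List.length-upTo (k x)))) ⟩
  Σℕ n (λ x → δ v x * k x)
    ≡⟨ Σℕ-δ n v k ⟩
  k v ∎
  where
  open ≡-Reasoning
  cnt-concat : ∀ l (f : Fin l → List (Fin n × ℤ)) →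
               cnt (map proj₁ (concat (tabulate f))) v ≡ Σℕ l (λ i → cnt (map proj₁ (f i)) v)
  cnt-concat zero    f = refl
  cnt-concat (suc l) f = trans
    (cong (λ us → cnt us v) (List.map-++ proj₁ (f zero) _))
    (trans (cnt-++ (map proj₁ (f zero)) _ v) (cong (cnt (map proj₁ (f zero)) v ℕ.+_) (cnt-concat l (f ∘ suc))))
  cnt-block : ∀ x (g : ℕ → ℤ) is → cnt (map proj₁ (map (λ i → x , g i) is)) v ≡ δ v x * length is
  cnt-block x g []       = sym (ℕ.*-zeroʳ (δ v x))
  cnt-block x g (_ ∷ is) = trans (cong₂ ℕ._+_ (δ-sym x v) (cnt-block x g is)) (sym (ℕ.*-suc (δ v x) _))

length-forms : ∀ {n} (k : Fin n → ℕ) d → length (forms k d) ≡ Σℕ n k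
length-forms {n} k d = trans (length-concat n _)
  (Σℕ-cong n (λ v → trans (List.length-map _ (upTo (k v))) (List.length-upTo (k v))))
  where
  length-concat : ∀ l (f : Fin l → List (Fin n × ℤ)) →
                  length (concat (tabulate f)) ≡ Σℕ l (λ i → length (f i))
  length-concat zero    f = refl
  length-concat (suc l) f = trans (List.length-++ (f zero)) (cong (length (f zero) ℕ.+_) (length-concat l (f ∘ suc)))

Σ-occ : ∀ {n} h (w : Fin h → Fin n) → Σℕ n (occ h w) ≡ h
Σ-occ {n} h w = trans (Σℕ-swap n h (λ v j → δ (w j) v))
  (trans (Σℕ-const h (λ j → Σδ≡1 n (w j))) (ℕ.*-identityʳ h))

-- Boundaries of edge functions.

module _ (G : Graph) where

  boundary : Fin (n G) → Fin (m G) → ℤ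
  boundary v e = + δ (tail G e) v - + δ (head G e) v

  if-[] : ∀ b (z : ℤ) → (if b then z else + 0) ≡ + [ b ] ℤ.* z
  if-[] true  z = sym (ℤ.*-identityˡ z)
  if-[] false z = refl

  netflow-boundary : ∀ φ v → netflow G φ v ≡ Σℤ (m G) (λ e → boundary v e ℤ.* φ e)
  netflow-boundary φ v = Σℤ-cong (m G) λ e → trans
    (cong₂ _-_ (if-[] (does (tail G e ≟ v)) (φ e)) (if-[] (does (head G e ≟ v)) (φ e)))
    (factor (+ δ (tail G e) v) (+ δ (head G e) v) (φ e))
    where
    factor : ∀ a b c → a ℤ.* c - b ℤ.* c ≡ (a - b) ℤ.* c
    factor = solve-∀

  Σ-netflow : ∀ φ → Σℤ (n G) (netflow G φ) ≡ + 0
  Σ-netflow φ = begin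
    Σℤ (n G) (netflow G φ)
      ≡⟨ Σℤ-cong (n G) (netflow-boundary φ) ⟩
    Σℤ (n G) (λ v → Σℤ (m G) (λ e → boundary v e ℤ.* φ e))
      ≡⟨ Σℤ-swap (n G) (m G) _ ⟩
    Σℤ (m G) (λ e → Σℤ (n G) (λ v → boundary v e ℤ.* φ e))
      ≡⟨ Σℤ-cong (m G) column ⟩
    Σℤ (m G) (λ _ → + 0)
      ≡⟨ Σℤ-0 (m G) ⟩
    + 0 ∎
    where
    open ≡-Reasoning
    distrib : ∀ a b c → (a - b) ℤ.* c ≡ a ℤ.* c - b ℤ.* c
    distrib = solve-∀
    column : ∀ e → Σℤ (n G) (λ v → boundary v e ℤ.* φ e) ≡ + 0
    column e = begin
      Σℤ (n G) (λ v → boundary v e ℤ.* φ e)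
        ≡⟨ Σℤ-cong (n G) (λ v → distrib (+ δ (tail G e) v) (+ δ (head G e) v) (φ e)) ⟩
      Σℤ (n G) (λ v → + δ (tail G e) v ℤ.* φ e - + δ (head G e) v ℤ.* φ e)
        ≡⟨ Σℤ-- (n G) _ _ ⟩
      Σℤ (n G) (λ v → + δ (tail G e) v ℤ.* φ e) - Σℤ (n G) (λ v → + δ (head G e) v ℤ.* φ e)
        ≡⟨ cong₂ _-_ (Σℤ-δ (n G) (tail G e) (λ _ → φ e)) (Σℤ-δ (n G) (head G e) (λ _ → φ e)) ⟩
      φ e - φ e
        ≡⟨ ℤ.+-inverseʳ (φ e) ⟩
      + 0 ∎

-- Edge values from Boolean variables, and a solution off the root.

module _ {G : Graph} {k h : ℕ} (H : SubMulti G k h) (D : Orientation h) where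

  -- linear counts the variable of edge j as 1 when lookup x j is false; reflecting it when D j is false
  -- makes it nonnegative along the reference orientation, at the cost of the constant in offset.
  selected : Vec Bool h → Fin (m G) → ℕ
  selected x e = Σℕ h (λ j → δ (orig H j) e * [ D j xor lookup x j ])

  selected≤ : ∀ x e → selected x e ≤ k
  selected≤ x e = ℕ.≤-trans
    (Σℕ-mono h (λ j → ℕ.≤-trans (ℕ.*-monoʳ-≤ (δ (orig H j) e) ([]≤1 (D j xor lookup x j))) (ℕ.≤-reflexive (ℕ.*-identityʳ _))))
    (copies≤ H e)

  -- The added 1 excludes 0; with at most p - 2 copies of each edge the value is at most p - 1.
  assignment : Vec Bool h → Fin (m G) → ℤ
  assignment x e = + suc (selected x e)

  -- The first sum comes from the 1 on every edge, the second from the reflected copies.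
  offset : Fin (n G) → ℤ
  offset v = Σℤ (m G) (boundary G v) ℤ.+ Σℤ h (λ j → boundary G v (orig H j) ℤ.* + [ not (D j) ])

  netflow-assignment : ∀ x v → netflow G (assignment x) v ≡ offset v ℤ.+ linear (flow H D v) x
  netflow-assignment x v = begin
    netflow G (assignment x) v
      ≡⟨ netflow-boundary G (assignment x) v ⟩
    Σℤ (m G) (λ e → B e ℤ.* + suc (selected x e))
      ≡⟨ trans (Σℤ-cong (m G) (λ e → expand (B e) (+ selected x e))) (Σℤ-+ (m G) _ _) ⟩
    Σℤ (m G) B ℤ.+ Σℤ (m G) (λ e → B e ℤ.* + selected x e)
      ≡⟨ cong (λ z → Σℤ (m G) B ℤ.+ z) by-copies ⟩
    Σℤ (m G) B ℤ.+ Σℤ h (λ j → B (orig H j) ℤ.* z j)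
      ≡⟨ cong (λ z → Σℤ (m G) B ℤ.+ z) (trans (Σℤ-cong h copy-flow) (Σℤ-+ h _ _)) ⟩
    Σℤ (m G) B ℤ.+ (Σℤ h (λ j → B (orig H j) ℤ.* + [ not (D j) ]) ℤ.+ linear (flow H D v) x)
      ≡⟨ ℤ.+-assoc (Σℤ (m G) B) _ _ ⟨
    offset v ℤ.+ linear (flow H D v) x ∎
    where
    open ≡-Reasoning
    B : Fin (m G) → ℤ
    B = boundary G v
    z : Fin h → ℤ
    z j = + [ D j xor lookup x j ]
    expand : ∀ a b → a ℤ.* (+ 1 ℤ.+ b) ≡ a ℤ.+ a ℤ.* b
    expand = solve-∀
    exchange : ∀ a b c → a ℤ.* (b ℤ.* c) ≡ b ℤ.* (a ℤ.* c)
    exchange = solve-∀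
    by-copies : Σℤ (m G) (λ e → B e ℤ.* + selected x e) ≡ Σℤ h (λ j → B (orig H j) ℤ.* z j)
    by-copies = begin
      Σℤ (m G) (λ e → B e ℤ.* + selected x e)
        ≡⟨ Σℤ-cong (m G) (λ e → trans (cong (λ s → B e ℤ.* s) (pos-Σ h _)) (sym (Σℤ-* h (B e) _))) ⟩
      Σℤ (m G) (λ e → Σℤ h (λ j → B e ℤ.* + (δ (orig H j) e * [ D j xor lookup x j ])))
        ≡⟨ Σℤ-swap (m G) h _ ⟩
      Σℤ h (λ j → Σℤ (m G) (λ e → B e ℤ.* + (δ (orig H j) e * [ D j xor lookup x j ])))
        ≡⟨ Σℤ-cong h (λ j → trans
             (Σℤ-cong (m G) (λ e → trans
               (cong (λ s → B e ℤ.* s) (ℤ.pos-* (δ (orig H j) e) [ D j xor lookup x j ]))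
               (exchange (B e) (+ δ (orig H j) e) (z j))))
             (Σℤ-δ (m G) (orig H j) (λ e → B e ℤ.* z j))) ⟩
      Σℤ h (λ j → B (orig H j) ℤ.* z j) ∎
    -- Let y be the variable of `j`. If `D j` is true the copy carries y; otherwise it carries 1 - y
    -- and the reference boundary is minus `flow`. Either way y has coefficient `flow H D v j`.
    copy-flow : ∀ j → B (orig H j) ℤ.* z j ≡
                B (orig H j) ℤ.* + [ not (D j) ] ℤ.+ + [ not (lookup x j) ] ℤ.* flow H D v j
    copy-flow j with D j | lookup x j
    ... | true  | true  = on-on (+ δ (tail G (orig H j)) v) (+ δ (head G (orig H j)) v)
      where
      on-on : ∀ t s → (t - s) ℤ.* + 0 ≡ (t - s) ℤ.* + 0 ℤ.+ + 0 ℤ.* (t - s)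
      on-on = solve-∀
    ... | true  | false = on-off (+ δ (tail G (orig H j)) v) (+ δ (head G (orig H j)) v)
      where
      on-off : ∀ t s → (t - s) ℤ.* + 1 ≡ (t - s) ℤ.* + 0 ℤ.+ + 1 ℤ.* (t - s)
      on-off = solve-∀
    ... | false | true  = off-on (+ δ (tail G (orig H j)) v) (+ δ (head G (orig H j)) v)
      where
      off-on : ∀ t s → (t - s) ℤ.* + 1 ≡ (t - s) ℤ.* + 1 ℤ.+ + 0 ℤ.* (s - t)
      off-on = solve-∀
    ... | false | false = off-off (+ δ (tail G (orig H j)) v) (+ δ (head G (orig H j)) v)
      where
      off-off : ∀ t s → (t - s) ℤ.* + 0 ≡ (t - s) ℤ.* + 1 ℤ.+ + 1 ℤ.* (s - t)
      off-off = solve-∀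

  -- At a point where the product is nonzero mod p no factor is divisible by p. Where the out-degree
  -- is p - 1, the factors exclude all shifts 1, ..., p - 1, so `residue` applies.
  flow-exists : ∀ {p} → Prime p → (∀ v → outdeg H D v < p) → ¬ (+ p ∣ + EE H D - + EO H D) →
    ∀ (b : Fin (n G) → ℤ) → Σ (Vec Bool h) λ x → ∀ v → outdeg H D v ≡ p ∸ 1 →
      + p Signed.∣ netflow G (assignment x) v - b v
  flow-exists {p} pp out<p ∤EE-EO b = x , λ v out≡ → residue p _ (λ i i<p-1 p∣ →
      ∤product (∣-factor (flow H D) x (∈-forms (outdeg H D) d v (subst (i <_) (sym out≡) i<p-1))
        (subst (+ p Signed.∣_) (shift-offset v (+ suc i)) p∣)))
    where
    instance _ = ℕ.nonTrivial⇒nonZero p {{prime⇒nonTrivial pp}}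
    d : Fin (n G) → ℤ
    d v = offset v - b v
    cs = forms (outdeg H D) d
    ∤permanent : ¬ (+ p ∣ + ∏! (n G) (outdeg H D) ℤ.* (+ EE H D - + EO H D))
    ∤permanent p∣ with euclidsLemma (∏! (n G) (outdeg H D)) _ pp
      (subst (p ℕ.∣_) (ℤ.abs-* (+ ∏! (n G) (outdeg H D)) (+ EE H D - + EO H D)) p∣)
    ... | inj₁ p∣∏! = prime∤∏! pp (n G) (outdeg H D) out<p p∣∏!
    ... | inj₂ p∣EE = ∤EE-EO p∣EE
    alt≡ : alt h (λ x → affineProduct (flow H D) x cs) ≡ + ∏! (n G) (outdeg H D) ℤ.* (+ EE H D - + EO H D)
    alt≡ = trans
      -- The out-degrees sum to the number of edges, so there are exactly `h` factors.
      (alt-affineProduct h (flow H D) cs (ℕ.≤-reflexive (trans (length-forms (outdeg H D) d) (Σ-occ h (dtail H D)))))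
      (perm-flow H D (map proj₁ cs) (cnt-forms (outdeg H D) d))
    found : Σ (Vec Bool h) λ x → ¬ (+ p Signed.∣ affineProduct (flow H D) x cs)
    found = ∣-alt h (λ p∣ → ∤permanent (Signed.∣⇒∣ᵤ (subst (+ p Signed.∣_) alt≡ p∣)))
    x = proj₁ found
    ∤product = proj₂ found
    regroup : ∀ o l b c → o ℤ.+ l - b ℤ.+ c ≡ l ℤ.+ (o - b ℤ.+ c)
    regroup = solve-∀
    shift-offset : ∀ v c → netflow G (assignment x) v - b v ℤ.+ c ≡ linear (flow H D v) x ℤ.+ (d v ℤ.+ c)
    shift-offset v c = trans (cong (λ s → s - b v ℤ.+ c) (netflow-assignment x v))
      (regroup (offset v) (linear (flow H D v) x) (b v) c)

theorem8 : (p : ℕ) → Prime p → 3 ≤ p → (G : Graph) →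
    (H : SubMulti G (p ∸ 2) ((p ∸ 1) * (n G ∸ 1))) →
    Σ (Fin (n G)) (λ u → Σ (Orientation ((p ∸ 1) * (n G ∸ 1))) λ D →
    ((v : Fin (n G)) → v ≢ u → outdeg H D v ≡ p ∸ 1) ×
    ¬ ((+ p) ∣ ((+ EE H D) - (+ EO H D)))) →
    ZpConnected p G
theorem8 p@(suc (suc q)) pp _ G H (u , D , out≡ , ∤EE-EO) b p∣Σb = assignment H D x , nowhere-zero , boundary≡b
  where
  -- The out-degrees off `u` already account for all (p - 1)(n - 1) edges.
  out-u≡0 : outdeg H D u ≡ 0
  out-u≡0 = ℕ.+-cancelʳ-≡ (suc q * (n G ∸ 1)) _ 0
    (trans (sym (Σℕ-except (n G) u (outdeg H D) out≡)) (Σ-occ _ (dtail H D)))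
  -- Keeps the factorials in the permanent prime to p.
  out<p : ∀ v → outdeg H D v < p
  out<p v with v ≟ u
  ... | yes refl rewrite out-u≡0 = s≤s z≤n
  ... | no v≢u   rewrite out≡ v v≢u = ℕ.≤-refl
  solution = flow-exists H D pp out<p ∤EE-EO b
  x = proj₁ solution
  nowhere-zero : ∀ e → ¬ (+ p ∣ assignment H D x e)
  nowhere-zero e p∣ = ℕ.<⇒≱ (s≤s (s≤s (selected≤ H D x e))) (ℕ.∣⇒≤ p∣)
  excess : Fin (n G) → ℤ
  excess v = netflow G (assignment H D x) v - b v
  p∣excess : ∀ v → v ≢ u → + p Signed.∣ excess v
  p∣excess v v≢u = proj₂ solution v (out≡ v v≢u)
  -- The net flow sums to 0 and p divides the sum of `b`; this settles the remaining vertex `u`.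
  p∣Σexcess : + p Signed.∣ Σℤ (n G) excess
  p∣Σexcess = subst (+ p Signed.∣_)
    (sym (trans (Σℤ-- (n G) _ b) (cong (_- Σℤ (n G) b) (Σ-netflow G (assignment H D x)))))
    (Signed.∣m∣n⇒∣m-n (Signed.divides (+ 0) refl) (Signed.∣ᵤ⇒∣ {i = Σℤ (n G) b} p∣Σb))
  boundary≡b : ∀ v → + p ∣ excess v
  boundary≡b v with v ≟ u
  ... | yes refl = Signed.∣⇒∣ᵤ {i = excess u} (∣-Σ-except (n G) u {excess} p∣Σexcess p∣excess)
  ... | no v≢u   = Signed.∣⇒∣ᵤ {i = excess v} (p∣excess v v≢u)
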